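{- Let $R$ be a commutative ring with unity, let $\mathcal{A}$ be a commutative unital $R$-algebra, and let $\sigma,\tau$ be two different non-zero unital $R$-algebra endomorphisms of $\mathcal{A}$. Suppose that, as an $R$-module, $\mathcal{A}$ is of finite rank $n$ and has an $R$-basis of the form $\{1,\alpha,\alpha^{2},\dots,\alpha^{n-1}\}$ for some $\alpha\in\mathcal{A}$. If an $R$-linear map $D:\mathcal{A}\to\mathcal{A}$ is a $(\sigma,\tau)$-derivation, then $$D(\alpha^{k})=\left(\sum_{(i,j)\in S_{k-1}}\sigma(\alpha^{i})\tau(\alpha^{j})\right)D(\alpha)$$ for all $k\in\{1,2,\dots,n-1\}$.
   Context: A $(\sigma,\tau)$-derivation of $\mathcal{A}$ is an $R$-linear map $D:\mathcal{A}\to\mathcal{A}$ with $D(xy)=D(x)\tau(y)+\sigma(x)D(y)$ for all $x,y\in\mathcal{A}$. For a non-negative integer $k$, $S_{k}$ is the set of all ordered pairs $(i,j)$ of non-negative integers with $i+j=k$. -}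

module Defs where

open import Algebra.Bundles using (CommutativeRing; Ring)
open import Algebra.Module.Bundles using (LeftModule)
open import Algebra.Module.Core using (Opₗ)
open import Algebra.Module.Morphism.Structures using (module LeftModuleMorphisms)
open import Algebra.Module.Structures using (IsLeftModule)
open import Algebra.Morphism.Structures using (module RingMorphisms)
import Algebra.Definitions.RawMonoid as RawMonoidDefinitions
import Algebra.Properties.Semiring.Exp as Exponentiation
open import Data.Fin.Base using (toℕ)
open import Data.List.Base using (List; applyUpTo; foldr; map)
open import Data.List.Membership.Propositional using (_∈_)
open import Data.List.Membership.Propositional.Properties using (∈-applyUpTo⁺; ∈-applyUpTo⁻)
open import Data.List.Relation.Unary.Unique.Propositional using (Unique)
open import Data.List.Relation.Unary.Unique.Propositional.Properties using (applyUpTo⁺₁)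
open import Data.Nat.Base as ℕ using (ℕ; suc; _∸_; s≤s)
open import Data.Nat.Properties using (m≤m+n; m+n∸m≡n; m+[n∸m]≡n; <⇒≢)
open import Data.Product.Base using (∃; _×_; _,_; proj₁)
open import Data.Vec.Functional using (Vector)
open import Function.Bundles using (_⇔_; mk⇔)
open import Level using (Level; _⊔_) renaming (suc to lsuc)
open import Relation.Binary.PropositionalEquality.Core using (_≡_; refl; cong; subst)

private
  variable
    r ℓr m ℓm : Level

-- S k = [ (0 , k) , (1 , k ∸ 1) , … , (k , 0) ] enumerates without repetition
-- the ordered pairs of naturals with sum k; see ∈-S and S-unique.
S : ℕ → List (ℕ × ℕ)
S k = applyUpTo (λ i → i , k ∸ i) (suc k)

∈-S : ∀ k {i j} → (i , j) ∈ S k ⇔ i ℕ.+ j ≡ k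
∈-S k {i} {j} = mk⇔ to from
  where
  to : (i , j) ∈ S k → i ℕ.+ j ≡ k
  to p with ∈-applyUpTo⁻ (λ i → i , k ∸ i) p
  ... | _ , s≤s i≤k , refl = m+[n∸m]≡n i≤k

  from : i ℕ.+ j ≡ k → (i , j) ∈ S k
  from refl = subst (λ x → (i , x) ∈ S k) (m+n∸m≡n i j)
                    (∈-applyUpTo⁺ (λ i → i , k ∸ i) (s≤s (m≤m+n i j)))

S-unique : ∀ k → Unique (S k)
S-unique k = applyUpTo⁺₁ (λ i → i , k ∸ i) (suc k)
                         (λ i<j _ eq → <⇒≢ i<j (cong proj₁ eq))

module _ {R : Ring r ℓr} (M : LeftModule R m ℓm) where
  private
    module R = Ring R
  open LeftModule M
  open RawMonoidDefinitions +ᴹ-rawMonoid using (sum)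

  linearCombination : ∀ {n} → Vector R.Carrier n → Vector Carrierᴹ n → Carrierᴹ
  linearCombination c b = sum (λ i → c i *ₗ b i)

  record IsBasis {n} (b : Vector Carrierᴹ n) : Set (r ⊔ ℓr ⊔ m ⊔ ℓm) where
    field
      linearlyIndependent : ∀ (c : Vector R.Carrier n) →
                            linearCombination c b ≈ᴹ 0ᴹ → ∀ i → c i R.≈ R.0#
      spanning            : ∀ x → ∃ λ (c : Vector R.Carrier n) →
                            x ≈ᴹ linearCombination c b

-- Associativity, commutativity and the unit come from the underlying ring.
-- One compatibility law between scaling and multiplication suffices, the
-- other one follows by commutativity.
record CommutativeAlgebra (R : CommutativeRing r ℓr) a ℓ
                          : Set (r ⊔ ℓr ⊔ lsuc (a ⊔ ℓ)) where
  private
    module R = CommutativeRing R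

  infixr 7 _*ₗ_

  field
    commutativeRing : CommutativeRing a ℓ

  open CommutativeRing commutativeRing public

  field
    _*ₗ_         : Opₗ R.Carrier Carrier
    isLeftModule : IsLeftModule R.ring _≈_ _+_ 0# (-_) _*ₗ_
    *ₗ-*-assoc   : ∀ s x y → (s *ₗ x) * y ≈ s *ₗ (x * y)

  leftModule : LeftModule R.ring a ℓ
  leftModule = record { isLeftModule = isLeftModule }

  open LeftModule leftModule public using (rawLeftModule)

  open Exponentiation semiring public using (_^_)

  powers : Carrier → ∀ n → Vector Carrier n
  powers α n i = α ^ toℕ i

  sumOver : ∀ {b} {B : Set b} → List B → (B → Carrier) → Carrier
  sumOver xs f = foldr _+_ 0# (map f xs)

module _ {R : CommutativeRing r ℓr} {a ℓ} (A : CommutativeAlgebra R a ℓ) where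
  private
    module R = CommutativeRing R
  open CommutativeAlgebra A
  open RingMorphisms rawRing rawRing using (IsRingHomomorphism)
  open LeftModuleMorphisms rawLeftModule rawLeftModule using (IsLeftModuleHomomorphism)

  -- IsRingHomomorphism includes preservation of 1#.
  record IsAlgebraEndomorphism (σ : Carrier → Carrier) : Set (r ⊔ a ⊔ ℓ) where
    field
      isRingHomomorphism : IsRingHomomorphism σ
      *ₗ-homo            : ∀ (s : R.Carrier) x → σ (s *ₗ x) ≈ s *ₗ σ x

  record IsDerivation (σ τ D : Carrier → Carrier) : Set (r ⊔ a ⊔ ℓ) where
    field
      isLinear : IsLeftModuleHomomorphism D
      leibniz  : ∀ x y → D (x * y) ≈ D x * τ y + σ x * D y

{-# OPTIONS --safe #-}
module Submission where

open import Defs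
open import Algebra.Bundles using (CommutativeRing)
open import Algebra.Module.Morphism.Structures using (module LeftModuleMorphisms)
open import Algebra.Morphism.Structures using (module RingMorphisms)
open import Data.List.Base using (List; []; _∷_; map)
open import Data.List.Properties using (map-applyUpTo)
open import Data.Nat.Base using (ℕ; zero; suc; _≤_; _∸_)
open import Data.Product.Base using (_×_; _,_; map₁)
open import Relation.Binary.PropositionalEquality.Core using (_≡_; cong; sym)
open import Relation.Nullary.Negation.Core using (¬_)
import Relation.Binary.Reasoning.Setoid as SetoidReasoning

-- Induction on the exponent. Write `D (α ^ suc k)` as c(k) times `D α`. The Leibniz rule for
-- `α * α ^ suc k`, with commutativity, gives c(0) = 1 and c(k+1) = τ(α^(k+1)) + σ(α) c(k). The sum
-- over `S k` obeys the same recursion (`sumOver-S-zero`, `sumOver-S-suc`), because the pairs with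
-- sum k+1 are (0 , k+1) together with the pairs with sum k whose first entry is raised by one
-- (`S-suc`).

S-suc : ∀ k → S (suc k) ≡ (0 , suc k) ∷ map (map₁ suc) (S k)
-- The head and `suc k ∸ suc i = k ∸ i` hold by computation, so only the fusion of `map` with
-- `applyUpTo` is left to prove.
S-suc k = cong ((0 , suc k) ∷_) (sym (map-applyUpTo (λ i → i , k ∸ i) (map₁ suc) (suc k)))

module _ {r ℓr a ℓ} {R : CommutativeRing r ℓr} (A : CommutativeAlgebra R a ℓ) where
  open CommutativeAlgebra A renaming (sym to ≈-sym)
  open SetoidReasoning setoid

  -- Reindexing and extraction of a common factor in one induction; used with `h` the shift of the
  -- first entry and `x` equal to `σ α`.
  sumOver-map-*ˡ : ∀ {b c} {B : Set b} {C : Set c} {h : B → C} {f : C → Carrier}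
                   {g : B → Carrier} {x} →
                   (∀ y → f (h y) ≈ x * g y) →
                   ∀ ys → sumOver (map h ys) f ≈ x * sumOver ys g
  sumOver-map-*ˡ {x = x} f∘h≈x*g [] = ≈-sym (zeroʳ x)
  sumOver-map-*ˡ {h = h} {f} {g} {x} f∘h≈x*g (y ∷ ys) = begin
    f (h y) + sumOver (map h ys) f  ≈⟨ +-cong (f∘h≈x*g y) (sumOver-map-*ˡ f∘h≈x*g ys) ⟩
    x * g y + x * sumOver ys g      ≈⟨ distribˡ x (g y) (sumOver ys g) ⟨
    x * (g y + sumOver ys g)        ∎

  module _ {σ τ D : Carrier → Carrier}
           (σ-endo : IsAlgebraEndomorphism A σ)
           (τ-endo : IsAlgebraEndomorphism A τ)
           (D-der : IsDerivation A σ τ D) where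
    private
      module σ = RingMorphisms.IsRingHomomorphism
                   (IsAlgebraEndomorphism.isRingHomomorphism σ-endo)
      module τ = RingMorphisms.IsRingHomomorphism
                   (IsAlgebraEndomorphism.isRingHomomorphism τ-endo)
    open IsDerivation D-der
    open LeftModuleMorphisms.IsLeftModuleHomomorphism isLinear using (⟦⟧-cong)

    module _ (α : Carrier) where
      private
        term : ℕ × ℕ → Carrier
        term (i , j) = σ (α ^ i) * τ (α ^ j)

      sumOver-S-zero : sumOver (S 0) term ≈ 1#
      sumOver-S-zero = begin
        σ 1# * τ 1# + 0#  ≈⟨ +-identityʳ _ ⟩
        σ 1# * τ 1#       ≈⟨ *-cong σ.1#-homo τ.1#-homo ⟩
        1# * 1#           ≈⟨ *-identityˡ 1# ⟩
        1#                ∎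

      -- The pair with first entry 0 contributes the `τ` summand, since `σ` preserves `1#`. In every
      -- other pair the first entry is positive, and multiplicativity of `σ` releases a factor
      -- `σ α`.
      sumOver-S-suc : ∀ k → sumOver (S (suc k)) term ≈
                            τ (α ^ suc k) + σ α * sumOver (S k) term
      sumOver-S-suc k = begin
        sumOver (S (suc k)) term
          ≡⟨ cong (λ ps → sumOver ps term) (S-suc k) ⟩
        σ 1# * τ (α ^ suc k) + sumOver (map (map₁ suc) (S k)) term
          ≈⟨ +-cong (trans (*-congʳ σ.1#-homo) (*-identityˡ _))
                    (sumOver-map-*ˡ term-suc (S k)) ⟩
        τ (α ^ suc k) + σ α * sumOver (S k) term  ∎
        where
        term-suc : ∀ p → term (map₁ suc p) ≈ σ α * term p
        term-suc (i , j) = trans (*-congʳ (σ.*-homo α (α ^ i))) (*-assoc _ _ _)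

      -- The exponent is `suc k` so that the index set is `S k` and no truncated subtraction enters
      -- the induction.
      derivation-^ : ∀ k → D (α ^ suc k) ≈ sumOver (S k) term * D α
      derivation-^ zero = begin
        D (α * 1#)                 ≈⟨ ⟦⟧-cong (*-identityʳ α) ⟩
        D α                        ≈⟨ *-identityˡ (D α) ⟨
        1# * D α                   ≈⟨ *-congʳ sumOver-S-zero ⟨
        sumOver (S 0) term * D α   ∎
      derivation-^ (suc k) = begin
        D (α * α ^ suc k)
          -- Splitting off a single `α` on the left puts `σ α` in front of the inductive term,
          -- matching the recursion of `sumOver-S-suc`.
          ≈⟨ leibniz α (α ^ suc k) ⟩
        D α * τ (α ^ suc k) + σ α * D (α ^ suc k)
          ≈⟨ +-cong (*-comm _ _) (*-congˡ (derivation-^ k)) ⟩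
        τ (α ^ suc k) * D α + σ α * (sumOver (S k) term * D α)
          ≈⟨ +-congˡ (*-assoc _ _ _) ⟨
        τ (α ^ suc k) * D α + σ α * sumOver (S k) term * D α
          ≈⟨ distribʳ (D α) _ _ ⟨
        (τ (α ^ suc k) + σ α * sumOver (S k) term) * D α
          ≈⟨ *-congʳ (sumOver-S-suc k) ⟨
        sumOver (S (suc k)) term * D α  ∎

theorem2p19 : ∀ {r ℓr a ℓ} (R : CommutativeRing r ℓr) (A : CommutativeAlgebra R a ℓ) →
    let open CommutativeAlgebra A in
    (σ τ : Carrier → Carrier) →
    IsAlgebraEndomorphism A σ →
    IsAlgebraEndomorphism A τ →
    ¬ (∀ x → σ x ≈ τ x) →
    ¬ (∀ x → σ x ≈ 0#) →
    ¬ (∀ x → τ x ≈ 0#) →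
    (n : ℕ) (α : Carrier) →
    IsBasis leftModule (powers α n) →
    (D : Carrier → Carrier) →
    IsDerivation A σ τ D →
    ∀ k → 1 ≤ k → k ≤ n ∸ 1 →
    D (α ^ k) ≈ sumOver (S (k ∸ 1)) (λ (i , j) → σ (α ^ i) * τ (α ^ j)) * D α
-- `1 ≤ k` rules out zero, and `suc k ∸ 1` computes to `k`.
theorem2p19 R A σ τ σ-endo τ-endo _ _ _ n α _ D D-der (suc k) _ _ =
  derivation-^ A σ-endo τ-endo D-der α k
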